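{- If $n\ge 0$ is an integer such that $B_{n+1}(t)-B_n(t)$ is a constant polynomial, then $n=2^{m}-2$ for some integer $m\ge 1$, and in that case $B_{n+1}(t)-B_n(t)=1$.
   Context: The Stern polynomials $B_n(t)\in\mathbb{Z}[t]$, $n\ge 0$, are defined by $B_0(t)=0$, $B_1(t)=1$, $B_{2n}(t)=tB_n(t)$ and $B_{2n+1}(t)=B_n(t)+B_{n+1}(t)$ for $n\ge 1$. -}

module Defs where

open import Data.Integer.Base as ℤ using (ℤ; 0ℤ; 1ℤ)
open import Data.List.Base using (List; []; _∷_; map)
open import Data.Nat.Base
  using (ℕ; zero; suc; _+_; _*_; _<_; _≤_; ⌊_/2⌋; ⌈_/2⌉; parity)
open import Data.Nat.Induction using (<-rec; <-wellFounded)
open import Data.Nat.Properties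
  using (+-suc; +-identityʳ; ⌊n/2⌋<n; ⌈n/2⌉<n; n≡⌊n+n/2⌋; n≡⌈n+n/2⌉)
open import Data.Parity.Base using (0ℙ; 1ℙ)
open import Data.Product.Base using (∃)
open import Induction.WellFounded using (module FixPoint)
open import Relation.Binary.PropositionalEquality
  using (_≡_; refl; sym; trans; cong; cong₂)

-- ℤ[t]: coefficient lists, constant term first.  Trailing zeros are allowed,
-- so equality of polynomials is _≈_, not _≡_.
Poly : Set
Poly = List ℤ

coeff : Poly → ℕ → ℤ
coeff []      _       = 0ℤ
coeff (a ∷ p) zero    = a
coeff (a ∷ p) (suc k) = coeff p k

infix 4 _≈_
_≈_ : Poly → Poly → Set
p ≈ q = ∀ k → coeff p k ≡ coeff q k

const : ℤ → Poly
const c = c ∷ []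

infixl 6 _⊕_ _⊖_
_⊕_ : Poly → Poly → Poly
[]      ⊕ q       = q
(a ∷ p) ⊕ []      = a ∷ p
(a ∷ p) ⊕ (b ∷ q) = (a ℤ.+ b) ∷ (p ⊕ q)

_⊖_ : Poly → Poly → Poly
p ⊖ q = p ⊕ map ℤ.-_ q

-- Multiplication by the indeterminate t.
infixr 7 t·_
t·_ : Poly → Poly
t· p = 0ℤ ∷ p

IsConstant : Poly → Set
IsConstant p = ∃ λ c → p ≈ const c

-- B is defined by well-founded recursion; B-zero, B-one, B-even and B-odd
-- below are its defining equations.
sternStep : ∀ n → (∀ {m} → m < n → Poly) → Poly
sternStep zero          rec = []
sternStep (suc zero)    rec = const 1ℤ
sternStep (suc (suc k)) rec with parity k
... | 0ℙ = t· rec (⌊n/2⌋<n (suc k))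
... | 1ℙ = rec (⌊n/2⌋<n (suc k)) ⊕ rec (⌈n/2⌉<n k)

B : ℕ → Poly
B = <-rec (λ _ → Poly) sternStep

private
  sternStep-ext : ∀ n {f g : ∀ {m} → m < n → Poly} →
                  (∀ {m} (m<n : m < n) → f m<n ≡ g m<n) →
                  sternStep n f ≡ sternStep n g
  sternStep-ext zero          f≡g = refl
  sternStep-ext (suc zero)    f≡g = refl
  sternStep-ext (suc (suc k)) f≡g with parity k
  ... | 0ℙ = cong t·_ (f≡g _)
  ... | 1ℙ = cong₂ _⊕_ (f≡g _) (f≡g _)

  B-unfold : ∀ n → B n ≡ sternStep n (λ {m} _ → B m)
  B-unfold n =
    FixPoint.unfold-wfRec <-wellFounded (λ _ → Poly) sternStep sternStep-ext {n}

  step-even : ∀ k → parity k ≡ 0ℙ →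
              B (suc (suc k)) ≡ t· B ⌊ suc (suc k) /2⌋
  step-even k eq with parity k | B-unfold (suc (suc k))
  step-even k refl | 0ℙ | u = u

  step-odd : ∀ k → parity k ≡ 1ℙ →
             B (suc (suc k)) ≡ B ⌊ suc (suc k) /2⌋ ⊕ B ⌈ suc (suc k) /2⌉
  step-odd k eq with parity k | B-unfold (suc (suc k))
  step-odd k refl | 1ℙ | u = u

  parity-n+n : ∀ n → parity (n + n) ≡ 0ℙ
  parity-n+n zero = refl
  parity-n+n (suc n) rewrite +-suc n n = parity-n+n n

  parity-1+n+n : ∀ n → parity (suc (n + n)) ≡ 1ℙ
  parity-1+n+n zero = refl
  parity-1+n+n (suc n) rewrite +-suc n n = parity-1+n+n n

B-zero : B 0 ≡ []
B-zero = refl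

B-one : B 1 ≡ const 1ℤ
B-one = refl

B-even : ∀ n → 1 ≤ n → B (2 * n) ≡ t· B n
B-even (suc n) _ rewrite +-identityʳ n | +-suc n n =
  trans (step-even (n + n) (parity-n+n n))
        (cong (λ k → t· B (suc k)) (sym (n≡⌊n+n/2⌋ n)))

B-odd : ∀ n → 1 ≤ n → B (2 * n + 1) ≡ B n ⊕ B (n + 1)
B-odd (suc n) _
  rewrite +-identityʳ n | +-suc n n | +-suc (n + n) 0 | +-identityʳ (n + n)
        | +-suc n 0 | +-identityʳ n =
  trans (step-odd (suc (n + n)) (parity-1+n+n n))
        (cong₂ (λ j k → B (suc j) ⊕ B (suc (suc k)))
               (sym (n≡⌈n+n/2⌉ n)) (sym (n≡⌊n+n/2⌋ n)))

{-# OPTIONS --safe #-}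

-- Evaluating at t = 2 gives B_n(2) = n, so a constant difference
-- B_{n+1} - B_n must be 1.  Evaluating at t = 1 gives the Stern diatomic
-- sequence s, hence s(n+1) = s(n) + 1.  For n = 2k+1 this reads
-- s(k+1) = s(k) + s(k+1) + 1, which is impossible; for n = 2k it reads
-- s(k+1) = 1, and s takes the value 1 only at powers of 2.  Conversely,
-- B_{2^m} = t^m and B_{2^m-1} = 1 + t + ... + t^{m-1}.
module Submission where

open import Defs
open import Data.Integer.Base as ℤ using (ℤ; 0ℤ; 1ℤ; +_)
import Data.Integer.Properties as ℤₚ
import Data.Integer.Tactic.RingSolver as ℤ-Ring
open import Data.List.Base using ([]; _∷_; map; replicate; _∷ʳ_)
open import Data.Nat.Base
  using (ℕ; zero; suc; _+_; _*_; _∸_; _^_; _≤_; _<_; z≤n; s≤s; z<s)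
open import Data.Nat.Induction using (<-rec)
open import Data.Nat.Properties
  using (+-comm; m<m+n; +-monoˡ-<; m≤n⇒m≤n+o; m≤n+m; m+n∸n≡m; m^n>0)
open import Data.Nat.Tactic.RingSolver using (solve-∀)
open import Data.Product.Base using (_×_; ∃; _,_)
open import Data.Sum.Base using (_⊎_; inj₁; inj₂)
open import Relation.Binary.PropositionalEquality
  using (_≡_; refl; sym; trans; cong; cong₂; subst; module ≡-Reasoning)
open import Relation.Nullary.Negation.Core using (¬_; contradiction)

open ≡-Reasoning

-- Evaluation at an integer and the Stern recurrence.

eval : ℤ → Poly → ℤ
eval x []      = 0ℤ
eval x (a ∷ p) = a ℤ.+ x ℤ.* eval x p

-- Trailing zeros are allowed, so the zero polynomial is also represented by nonempty lists;
-- `eval-cong` meets them when its two lists differ in length.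
eval-zero : ∀ x p → p ≈ [] → eval x p ≡ 0ℤ
eval-zero x []      p≈0 = refl
eval-zero x (a ∷ p) p≈0
  rewrite p≈0 0 | eval-zero x p (λ k → p≈0 (suc k)) = trans (ℤₚ.+-identityˡ _) (ℤₚ.*-zeroʳ x)

eval-cong : ∀ x p q → p ≈ q → eval x p ≡ eval x q
eval-cong x []      q       p≈q = sym (eval-zero x q (λ k → sym (p≈q k)))
eval-cong x (a ∷ p) []      p≈q = eval-zero x (a ∷ p) p≈q
eval-cong x (a ∷ p) (b ∷ q) p≈q =
  cong₂ (λ c e → c ℤ.+ x ℤ.* e) (p≈q 0) (eval-cong x p q (λ k → p≈q (suc k)))

eval-const : ∀ x c → eval x (const c) ≡ c
eval-const x c = trans (cong (λ e → c ℤ.+ e) (ℤₚ.*-zeroʳ x)) (ℤₚ.+-identityʳ c)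

eval-⊕ : ∀ x p q → eval x (p ⊕ q) ≡ eval x p ℤ.+ eval x q
eval-⊕ x []      q       = sym (ℤₚ.+-identityˡ _)
eval-⊕ x (a ∷ p) []      = sym (ℤₚ.+-identityʳ _)
eval-⊕ x (a ∷ p) (b ∷ q) rewrite eval-⊕ x p q = rearrange a b x (eval x p) (eval x q)
  where
  rearrange : ∀ a b x u v →
    a ℤ.+ b ℤ.+ x ℤ.* (u ℤ.+ v) ≡ a ℤ.+ x ℤ.* u ℤ.+ (b ℤ.+ x ℤ.* v)
  rearrange = ℤ-Ring.solve-∀

eval-neg : ∀ x p → eval x (map ℤ.-_ p) ≡ ℤ.- eval x p
eval-neg x []      = refl
eval-neg x (a ∷ p) rewrite eval-neg x p = rearrange a x (eval x p)
  where
  rearrange : ∀ a x u → ℤ.- a ℤ.+ x ℤ.* (ℤ.- u) ≡ ℤ.- (a ℤ.+ x ℤ.* u)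
  rearrange = ℤ-Ring.solve-∀

eval-⊖ : ∀ x p q → eval x (p ⊖ q) ≡ eval x p ℤ.- eval x q
eval-⊖ x p q = trans (eval-⊕ x p (map ℤ.-_ q)) (cong (λ e → eval x p ℤ.+ e) (eval-neg x q))

eval-t· : ∀ x p → eval x (t· p) ≡ x ℤ.* eval x p
eval-t· x p = ℤₚ.+-identityˡ _

-- The index 0 lies outside the recurrence for `B`, but there both sides vanish. Including it lets
-- later splits into 2k and 2k + 1 treat k = 0 uniformly.
eval-B-even : ∀ x n → eval x (B (2 * n)) ≡ x ℤ.* eval x (B n)
eval-B-even x zero    = sym (ℤₚ.*-zeroʳ x)
eval-B-even x (suc n) = trans (cong (eval x) (B-even (suc n) (s≤s z≤n))) (eval-t· x (B (suc n)))

eval-B-odd : ∀ x n → eval x (B (2 * n + 1)) ≡ eval x (B n) ℤ.+ eval x (B (n + 1))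
eval-B-odd x zero    = sym (ℤₚ.+-identityˡ _)
eval-B-odd x (suc n) = trans (cong (eval x) (B-odd (suc n) (s≤s z≤n))) (eval-⊕ x (B (suc n)) _)

even⊎odd : ∀ n → (∃ λ k → n ≡ 2 * k) ⊎ (∃ λ k → n ≡ 2 * k + 1)
even⊎odd zero = inj₁ (0 , refl)
even⊎odd (suc n) with even⊎odd n
... | inj₁ (k , refl) = inj₂ (k , +-comm 1 (2 * k))
... | inj₂ (k , refl) = inj₁ (suc k , double-suc k)
  where
  double-suc : ∀ k → suc (2 * k + 1) ≡ 2 * suc k
  double-suc = solve-∀

-- For n ≥ 1 both n and n + 1 lie below 2n + 1. At n = 0 the odd step would deduce `P 1` from
-- itself, so 1 is a second base case.
stern-induction : ∀ (P : ℕ → Set) → P 0 → P 1 →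
                  (∀ n → 1 ≤ n → P n → P (2 * n)) →
                  (∀ n → 1 ≤ n → P n → P (n + 1) → P (2 * n + 1)) →
                  ∀ n → P n
stern-induction P P0 P1 even odd = <-rec P step
  where
  n<2n : ∀ n → suc n < 2 * suc n
  n<2n n = m<m+n (suc n) z<s

  n+1<2n+1 : ∀ n → suc n + 1 < 2 * suc n + 1
  n+1<2n+1 n = +-monoˡ-< 1 (n<2n n)

  step : ∀ n → (∀ {m} → m < n → P m) → P n
  step n rec with even⊎odd n
  ... | inj₁ (zero  , refl) = P0
  ... | inj₂ (zero  , refl) = P1
  ... | inj₁ (suc k , refl) = even (suc k) (s≤s z≤n) (rec (n<2n k))
  ... | inj₂ (suc k , refl) = odd (suc k) (s≤s z≤n)
    (rec (m≤n⇒m≤n+o 1 (n<2n k)))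
    (rec (n+1<2n+1 k))

-- At t = 2 the recurrence becomes 2n = 2 · n and 2n + 1 = n + (n + 1), which the identity sequence
-- satisfies.
eval-2-B : ∀ n → eval (+ 2) (B n) ≡ + n
eval-2-B = stern-induction (λ n → eval (+ 2) (B n) ≡ + n) refl refl
  (λ n _ ih → begin
    eval (+ 2) (B (2 * n))    ≡⟨ eval-B-even (+ 2) n ⟩
    + 2 ℤ.* eval (+ 2) (B n)  ≡⟨ cong (λ e → + 2 ℤ.* e) ih ⟩
    + 2 ℤ.* + n               ≡⟨ ℤₚ.pos-* 2 n ⟨
    + (2 * n)                 ∎)
  (λ n _ ih₀ ih₁ → begin
    eval (+ 2) (B (2 * n + 1))                   ≡⟨ eval-B-odd (+ 2) n ⟩
    eval (+ 2) (B n) ℤ.+ eval (+ 2) (B (n + 1))  ≡⟨ cong₂ ℤ._+_ ih₀ ih₁ ⟩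
    + (n + (n + 1))                              ≡⟨ cong +_ (regroup n) ⟩
    + (2 * n + 1)                                ∎)
  where
  regroup : ∀ n → n + (n + 1) ≡ 2 * n + 1
  regroup = solve-∀

-- Stern's diatomic sequence.

diatomic : ℕ → ℤ
diatomic n = eval 1ℤ (B n)

diatomic-even : ∀ n → diatomic (2 * n) ≡ diatomic n
diatomic-even n = trans (eval-B-even 1ℤ n) (ℤₚ.*-identityˡ _)

diatomic-positive : ∀ n → 1 ≤ n → 1ℤ ℤ.≤ diatomic n
diatomic-positive = stern-induction (λ n → 1 ≤ n → 1ℤ ℤ.≤ diatomic n)
  (λ ())
  (λ _ → ℤₚ.≤-refl)
  (λ n 1≤n ih _ → subst (1ℤ ℤ.≤_) (sym (diatomic-even n)) (ih 1≤n))
  (λ n 1≤n ih₀ ih₁ _ → subst (1ℤ ℤ.≤_) (sym (eval-B-odd 1ℤ n))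
    (ℤₚ.≤-trans (ℤ.+≤+ (s≤s z≤n)) (ℤₚ.+-mono-≤ (ih₀ 1≤n) (ih₁ (m≤n+m 1 n)))))

diatomic-nonneg : ∀ n → 0ℤ ℤ.≤ diatomic n
diatomic-nonneg zero    = ℤₚ.≤-refl
diatomic-nonneg (suc n) = ℤₚ.≤-trans (ℤ.+≤+ z≤n) (diatomic-positive (suc n) (s≤s z≤n))

-- At an odd index above 1 the value is a sum of two positive terms, hence at least 2. So the value
-- 1 can only be reached from index 1 by doubling.
diatomic≡1⇒power-of-2 : ∀ n → diatomic n ≡ 1ℤ → ∃ λ m → n ≡ 2 ^ m
diatomic≡1⇒power-of-2 = stern-induction (λ n → diatomic n ≡ 1ℤ → ∃ λ m → n ≡ 2 ^ m)
  (λ ())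
  (λ _ → 0 , refl)
  even
  (λ n 1≤n _ _ sum≡1 → contradiction
    (subst (+ 2 ℤ.≤_) (trans (sym (eval-B-odd 1ℤ n)) sum≡1)
      (ℤₚ.+-mono-≤ (diatomic-positive n 1≤n) (diatomic-positive (n + 1) (m≤n+m 1 n))))
    2≰1)
  where
  2≰1 : ¬ + 2 ℤ.≤ 1ℤ
  2≰1 (ℤ.+≤+ (s≤s ()))

  even : ∀ n → 1 ≤ n → (diatomic n ≡ 1ℤ → ∃ λ m → n ≡ 2 ^ m) →
         diatomic (2 * n) ≡ 1ℤ → ∃ λ m → 2 * n ≡ 2 ^ m
  even n _ ih s≡1 with ih (trans (sym (diatomic-even n)) s≡1)
  ... | m , n≡2^m = suc m , cong (2 *_) n≡2^m

-- Constant differences force n = 2^m - 2.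

eval-difference : ∀ x n c → B (n + 1) ⊖ B n ≈ const c →
                  eval x (B (n + 1)) ℤ.- eval x (B n) ≡ c
eval-difference x n c Δ≈c = begin
  eval x (B (n + 1)) ℤ.- eval x (B n)  ≡⟨ eval-⊖ x (B (n + 1)) (B n) ⟨
  eval x (B (n + 1) ⊖ B n)             ≡⟨ eval-cong x (B (n + 1) ⊖ B n) (const c) Δ≈c ⟩
  eval x (const c)                     ≡⟨ eval-const x c ⟩
  c                                    ∎

constant-difference≡1 : ∀ n c → B (n + 1) ⊖ B n ≈ const c → c ≡ 1ℤ
constant-difference≡1 n c Δ≈c = begin
  c                                              ≡⟨ eval-difference (+ 2) n c Δ≈c ⟨
  eval (+ 2) (B (n + 1)) ℤ.- eval (+ 2) (B n)    ≡⟨ cong₂ ℤ._-_ (eval-2-B (n + 1)) (eval-2-B n) ⟩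
  (+ n ℤ.+ 1ℤ) ℤ.- + n                           ≡⟨ cancel (+ n) ⟩
  1ℤ                                             ∎
  where
  cancel : ∀ a → (a ℤ.+ 1ℤ) ℤ.- a ≡ 1ℤ
  cancel = ℤ-Ring.solve-∀

diatomic-difference : ∀ n → IsConstant (B (n + 1) ⊖ B n) →
                      diatomic (n + 1) ℤ.- diatomic n ≡ 1ℤ
diatomic-difference n (c , Δ≈c) =
  trans (eval-difference 1ℤ n c Δ≈c) (constant-difference≡1 n c Δ≈c)

diatomic-step-even : ∀ k → diatomic (2 * k + 1) ℤ.- diatomic (2 * k) ≡ diatomic (k + 1)
diatomic-step-even k rewrite eval-B-odd 1ℤ k | diatomic-even k = cancel (diatomic k) (diatomic (k + 1))
  where
  cancel : ∀ a b → (a ℤ.+ b) ℤ.- a ≡ b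
  cancel = ℤ-Ring.solve-∀

2k+1+1≡2[k+1] : ∀ k → 2 * k + 1 + 1 ≡ 2 * (k + 1)
2k+1+1≡2[k+1] = solve-∀

diatomic-step-odd : ∀ k → diatomic (2 * k + 1 + 1) ℤ.- diatomic (2 * k + 1) ≡ ℤ.- diatomic k
diatomic-step-odd k
  rewrite 2k+1+1≡2[k+1] k | eval-B-odd 1ℤ k | diatomic-even (k + 1) = cancel (diatomic k) (diatomic (k + 1))
  where
  cancel : ∀ a b → b ℤ.- (a ℤ.+ b) ≡ ℤ.- a
  cancel = ℤ-Ring.solve-∀

constant-difference⇒ : ∀ n → IsConstant (B (n + 1) ⊖ B n) → ∃ λ m → 1 ≤ m × n ≡ 2 ^ m ∸ 2
constant-difference⇒ n constant with even⊎odd n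
... | inj₁ (k , refl)
  with diatomic≡1⇒power-of-2 (k + 1)
         (trans (sym (diatomic-step-even k)) (diatomic-difference n constant))
-- From k + 1 = 2^m follows 2k = 2^(m+1) - 2, so the exponent is `suc m`, automatically at least 1.
...   | m , k+1≡2^m = suc m , s≤s z≤n , (begin
  2 * k            ≡⟨ m+n∸n≡m (2 * k) 2 ⟨
  2 * k + 2 ∸ 2    ≡⟨ cong (_∸ 2) (factor k) ⟩
  2 * (k + 1) ∸ 2  ≡⟨ cong (λ j → 2 * j ∸ 2) k+1≡2^m ⟩
  2 ^ suc m ∸ 2    ∎)
  where
  factor : ∀ k → 2 * k + 2 ≡ 2 * (k + 1)
  factor = solve-∀
-- Here 1 = -s(k) ≤ 0. Nonnegativity of s is the right bound, as n = 1 gives k = 0 and s(0) = 0.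
constant-difference⇒ n constant | inj₂ (k , refl) = contradiction
  (subst (ℤ._≤ 0ℤ) (trans (sym (diatomic-step-odd k)) (diatomic-difference n constant))
    (ℤₚ.neg-mono-≤ (diatomic-nonneg k)))
  λ { (ℤ.+≤+ ()) }

-- The converse, through Mersenne numbers.

-- This is 2^m - 1, given by a recursion that avoids truncated subtraction and has the shape of the
-- odd case of the Stern recurrence.
mersenne : ℕ → ℕ
mersenne zero    = 0
mersenne (suc m) = 2 * mersenne m + 1

mersenne+1 : ∀ m → mersenne m + 1 ≡ 2 ^ m
mersenne+1 zero    = refl
mersenne+1 (suc m) = trans (2k+1+1≡2[k+1] (mersenne m)) (cong (2 *_) (mersenne+1 m))

2^[1+m]∸2 : ∀ m → 2 ^ suc m ∸ 2 ≡ 2 * mersenne m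
2^[1+m]∸2 m = begin
  2 ^ suc m ∸ 2             ≡⟨ cong (λ j → 2 * j ∸ 2) (mersenne+1 m) ⟨
  2 * (mersenne m + 1) ∸ 2  ≡⟨ cong (_∸ 2) (expand (mersenne m)) ⟩
  2 * mersenne m + 2 ∸ 2    ≡⟨ m+n∸n≡m (2 * mersenne m) 2 ⟩
  2 * mersenne m            ∎
  where
  expand : ∀ k → 2 * (k + 1) ≡ 2 * k + 2
  expand = solve-∀

B-power-of-2 : ∀ m → B (2 ^ m) ≡ replicate m 0ℤ ∷ʳ 1ℤ
B-power-of-2 zero    = refl
B-power-of-2 (suc m) = trans (B-even (2 ^ m) (m^n>0 2 m)) (cong t·_ (B-power-of-2 m))

replicate-⊕ : ∀ m → replicate m 1ℤ ⊕ (replicate m 0ℤ ∷ʳ 1ℤ) ≡ replicate (suc m) 1ℤ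
replicate-⊕ zero    = refl
replicate-⊕ (suc m) = cong (1ℤ ∷_) (replicate-⊕ m)

1≤mersenne : ∀ m → 1 ≤ mersenne (suc m)
1≤mersenne m = m≤n+m 1 (2 * mersenne m)

-- With k = 2^m - 1, the step to 2k + 1 adds `B (k + 1)`, which is t^m, to 1 + t + ... + t^(m-1).
B-mersenne : ∀ m → B (mersenne m) ≡ replicate m 1ℤ
B-mersenne zero          = refl
-- `B-odd` starts at n = 1, so the index 1 = 2 · 0 + 1 is settled by computation.
B-mersenne (suc zero)    = refl
B-mersenne (suc (suc m)) = begin
  B (2 * k + 1)                                              ≡⟨ B-odd k (1≤mersenne m) ⟩
  B k ⊕ B (k + 1)                                            ≡⟨ cong (λ j → B k ⊕ B j) (mersenne+1 (suc m)) ⟩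
  B k ⊕ B (2 ^ suc m)                                        ≡⟨ cong₂ _⊕_ (B-mersenne (suc m)) (B-power-of-2 (suc m)) ⟩
  replicate (suc m) 1ℤ ⊕ (replicate (suc m) 0ℤ ∷ʳ 1ℤ)        ≡⟨ replicate-⊕ (suc m) ⟩
  replicate (suc (suc m)) 1ℤ                                 ∎
  where k = mersenne (suc m)

p⊖p≈0 : ∀ p → p ⊖ p ≈ []
p⊖p≈0 []      k       = refl
p⊖p≈0 (a ∷ p) zero    = ℤₚ.+-inverseʳ a
p⊖p≈0 (a ∷ p) (suc k) = p⊖p≈0 p k

-- With S = 1 + ... + t^(m-1), the value of `B` at `mersenne m`, the two terms are 1 + tS and tS.
difference-at-double-mersenne : ∀ m →
  B (2 * mersenne m + 1) ⊖ B (2 * mersenne m) ≈ const 1ℤ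
difference-at-double-mersenne zero    k = refl
difference-at-double-mersenne (suc m) k
  rewrite B-mersenne (suc (suc m))
        | B-even (mersenne (suc m)) (1≤mersenne m)
        | B-mersenne (suc m)
  with k
... | zero  = refl
-- Beyond the constant term the difference is S - S, a list of zeros that is not empty; hence the
-- comparison by coefficients.
... | suc j = p⊖p≈0 (replicate (suc m) 1ℤ) j

theorem5p2 : ∀ (n : ℕ) →
    (IsConstant (B (n + 1) ⊖ B n) → ∃ λ m → 1 ≤ m × n ≡ 2 ^ m ∸ 2) ×
    (∀ m → 1 ≤ m → n ≡ 2 ^ m ∸ 2 → B (n + 1) ⊖ B n ≈ const 1ℤ)
theorem5p2 n = constant-difference⇒ n , λ where
  (suc m) _ n≡2^[1+m]∸2 →
    subst (λ j → B (j + 1) ⊖ B j ≈ const 1ℤ)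
      (sym (trans n≡2^[1+m]∸2 (2^[1+m]∸2 m)))
      (difference-at-double-mersenne m)
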